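{- For each positive integer $k$, $\mathrm{minprol}(k)\geqslant\lceil k^2/2+2k+1\rceil$; that is, if $n>k$ and some $\sigma\in S_n$ is $k$-prolific, then $n\geqslant\lceil k^2/2+2k+1\rceil$.
   Context: $S_n$ is the set of permutations of $[n]$. A permutation $\sigma\in S_n$ contains $\pi\in S_r$ ($\pi\preceq\sigma$) if there are indices $i_1<\dots<i_r$ with $\sigma(i_1)\cdots\sigma(i_r)$ in the same relative order as $\pi$; for $n>k\geqslant1$, $\sigma$ is $k$-prolific if $|\{\pi\in S_{n-k}:\pi\preceq\sigma\}|=\binom{n}{k}$. $\mathrm{minprol}(k)$ is the minimum $n$ for which a $k$-prolific permutation in $S_n$ exists. -}

module Defs where

open import Data.Nat using (ℕ; _∸_)
open import Data.Nat.Combinatorics using (_C_)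
open import Data.Fin using (Fin; _<_)
open import Data.Vec using (Vec; lookup)
open import Data.List using (List; length)
open import Data.List.Membership.Propositional using (_∈_)
open import Data.List.Relation.Unary.Unique.Propositional using (Unique)
open import Data.Product using (Σ; _×_; ∃)
open import Function.Bundles using (_⇔_)
open import Relation.Binary.PropositionalEquality using (_≡_)

-- A permutation of [m] is represented by its one-line notation
-- σ(0) σ(1) … σ(m-1) (0-indexed), i.e. a vector of length m over Fin m
-- whose entries are pairwise distinct (hence a bijection Fin m → Fin m).
IsPerm : {m : ℕ} → Vec (Fin m) m → Set
IsPerm {m} v = ∀ (i j : Fin m) → lookup v i ≡ lookup v j → i ≡ j

_≼_ : {r n : ℕ} → Vec (Fin r) r → Vec (Fin n) n → Set
_≼_ {r} {n} π σ =
  ∃ λ (e : Fin r → Fin n) →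
    (∀ i j → i < j → e i < e j) ×
    (∀ i j → (lookup π i < lookup π j) ⇔ (lookup σ (e i) < lookup σ (e j)))

PatternCount : {n : ℕ} → Vec (Fin n) n → (r c : ℕ) → Set
PatternCount σ r c =
  Σ (List (Vec (Fin r) r)) λ L →
    Unique L ×
    (∀ π → (π ∈ L) ⇔ (IsPerm π × π ≼ σ)) ×
    length L ≡ c

Prolific : {n : ℕ} → (k : ℕ) → Vec (Fin n) n → Set
Prolific {n} k σ = PatternCount σ (n ∸ k) (n C k)

{-# OPTIONS --safe #-}
module Submission where

-- If two points of σ are at taxicab distance at most k + 1, then deleting the at most k - 1 points lying
-- strictly between them horizontally or vertically, a few more, and finally one of the two, gives the
-- same pattern whichever of the two goes. As there are exactly C(n,k) sets of k points to delete, a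
-- k-prolific σ has all points pairwise at distance at least d = k + 2.
-- Hence the diamonds of diameter d around the points have disjoint interiors. Every row y at distance at
-- least (d - 1)/2 from the top and the bottom meets them in intervals of total length ⌈d²/2⌉. These stick
-- out of the range of the n columns by at most about d/2 at either end, a first lower bound on n. Among
-- the rows, those in which they stick out far on the left (right) number at most m² for an m close to
-- d/2, and the first bound leaves a row that avoids them; there the total overhang is at most 2, so
-- ⌈d²/2⌉ ≤ n + 1.

open import Defs
open import Data.Nat using (ℕ; zero; suc; _+_; _*_; _∸_; _≤_; _<_; s≤s; z≤n; z<s; s<s; s≤s⁻¹; s<s⁻¹; ∣_-_∣; ⌈_/2⌉; ⌊_/2⌋)
import Data.Nat.Properties as ℕ
open import Data.Nat.Combinatorics using (_C_; nCk≡nC[n∸k]; nCk+nC[k+1]≡[n+1]C[k+1])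
open import Data.Nat.Tactic.RingSolver using (solve-∀)
open import Data.Fin as Fin using (Fin; zero; suc; toℕ; cast; punchIn; punchOut; _↑ʳ_)
import Data.Fin.Properties as Fin
open import Data.Fin.Permutation using (permutation)
open import Data.Vec using (Vec; lookup; tabulate)
open import Data.Vec.Properties using (tabulate-cong; tabulate∘lookup)
import Data.Vec.Functional as Vector
open import Data.List as List using (List; []; _∷_; _++_; length; map; applyUpTo; replicate)
open import Data.List.Properties using (length-++; length-map; length-applyUpTo; length-replicate)
open import Data.List.Membership.Propositional using (_∈_; _∉_)
open import Data.List.Membership.Propositional.Properties using (∈-++⁺ˡ; ∈-++⁺ʳ; ∈-map⁺; ∈-applyUpTo⁺; ∈-lookup)
open import Data.List.Membership.DecPropositional ℕ._≟_ using (_∈?_)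
open import Data.List.Relation.Unary.All as All using (All; []; _∷_)
import Data.List.Relation.Unary.All.Properties as All
open import Data.List.Relation.Unary.Any as Any using (Any; here; there; index)
import Data.List.Relation.Unary.Any.Properties as Any
open import Data.List.Relation.Unary.AllPairs using (AllPairs; _∷_)
open import Data.Product using (_×_; _,_; ∃; ∃₂; proj₁; proj₂)
open import Data.Sum using (_⊎_; inj₁; inj₂)
open import Algebra.Properties.CommutativeMonoid.Sum ℕ.+-0-commutativeMonoid using (sum; sum-permute; sum-cong-≗)
open import Function using (_∘_; _⇔_; mk⇔; Equivalence)
open import Function.Properties.Equivalence using () renaming (trans to ⇔-trans; sym to ⇔-sym)
open import Relation.Nullary using (¬_; Dec; yes; no; contradiction)
open import Relation.Nullary.Decidable using (¬?; decidable-stable)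
open import Relation.Binary.Definitions using (tri<; tri≈; tri>)
open import Relation.Binary.PropositionalEquality using (_≡_; _≢_; _≗_; refl; sym; trans; cong; cong₂; subst; subst₂; module ≡-Reasoning)

-- Increasing maps as sets of columns

Increasing : ∀ {r n} → (Fin r → Fin n) → Set
Increasing e = ∀ i j → i Fin.< j → e i Fin.< e j

increasing-injective : ∀ {r n} {e : Fin r → Fin n} → Increasing e → ∀ i j → e i ≡ e j → i ≡ j
increasing-injective inc i j eq with Fin.<-cmp i j
... | tri< i<j _ _ = contradiction (cong toℕ eq) (ℕ.<⇒≢ (inc i j i<j))
... | tri≈ _ i≡j _ = i≡j
... | tri> _ _ j<i = contradiction (cong toℕ (sym eq)) (ℕ.<⇒≢ (inc j i j<i))

increasing⇒inflationary : ∀ {r n} {e : Fin r → Fin n} → Increasing e → ∀ i → toℕ i ≤ toℕ (e i)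
increasing⇒inflationary {suc r} {n} {e} inc zero = z≤n
increasing⇒inflationary {suc r} {n} {e} inc (suc i) = ℕ.≤-<-trans
  (increasing⇒inflationary {e = e ∘ Fin.inject₁}
    (λ u v u<v → inc _ _ (subst₂ _<_ (sym (Fin.toℕ-inject₁ u)) (sym (Fin.toℕ-inject₁ v)) u<v)) i)
  (inc (Fin.inject₁ i) (suc i) (s≤s (ℕ.≤-reflexive (Fin.toℕ-inject₁ i))))

increasing-head-≤ : ∀ {r n} {e : Fin (suc r) → Fin n} → Increasing e → ∀ i → toℕ (e zero) ≤ toℕ (e i)
increasing-head-≤ inc zero    = ℕ.≤-refl
increasing-head-≤ inc (suc i) = ℕ.<⇒≤ (inc zero (suc i) z<s)

predecessors : ∀ {r n} (g : Fin r → Fin (suc n)) → (∀ i → 0 < toℕ (g i)) →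
               ∃ λ (h : Fin r → Fin n) → suc ∘ h ≗ g
predecessors g pos = (λ i → proj₁ (pred (g i) (pos i))) , (λ i → proj₂ (pred (g i) (pos i)))
  where
  pred : ∀ {n} (x : Fin (suc n)) → 0 < toℕ x → ∃ λ y → suc y ≡ x
  pred (suc y) _ = y , refl

-- Increasing maps encode `r`-subsets of the `n` columns. The split is on whether column 0 lies in
-- the image, so the lengths follow Pascal's rule.
allIncreasing : ∀ r n → List (Fin r → Fin n)
allIncreasing zero    n       = List.[ (λ ()) ]
allIncreasing (suc r) zero    = []
allIncreasing (suc r) (suc n) =
  map (λ f → zero Vector.∷ (suc ∘ f)) (allIncreasing r n) ++
  map (suc ∘_) (allIncreasing (suc r) n)

length-allIncreasing : ∀ r n → length (allIncreasing r n) ≡ n C r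
length-allIncreasing zero    n       = refl
length-allIncreasing (suc r) zero    = refl
length-allIncreasing (suc r) (suc n) = begin
  length (map consZero fs ++ map (suc ∘_) gs)           ≡⟨ length-++ (map consZero fs) ⟩
  length (map consZero fs) + length (map (suc ∘_) gs)   ≡⟨ cong₂ _+_ (length-map _ fs) (length-map _ gs) ⟩
  length fs + length gs                                 ≡⟨ cong₂ _+_ (length-allIncreasing r n) (length-allIncreasing (suc r) n) ⟩
  n C r + n C suc r                                     ≡⟨ nCk+nC[k+1]≡[n+1]C[k+1] n r ⟩
  suc n C suc r                                         ∎
  where
  open ≡-Reasoning
  consZero : (Fin r → Fin n) → Fin (suc r) → Fin (suc n)
  consZero f = zero Vector.∷ (suc ∘ f)
  fs = allIncreasing r n
  gs = allIncreasing (suc r) n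

allIncreasing-complete : ∀ r n (e : Fin r → Fin n) → Increasing e → Any (_≗ e) (allIncreasing r n)
allIncreasing-complete zero    n       e inc = here λ ()
allIncreasing-complete (suc r) zero    e inc with () ← e zero
allIncreasing-complete (suc r) (suc n) e inc with e zero in e0
... | zero
  with g , g-eq ← predecessors (e ∘ suc) (λ i → ℕ.≤-<-trans z≤n (inc zero (suc i) z<s))
  = Any.++⁺ˡ (Any.map⁺ (Any.map extend (allIncreasing-complete r n g
      (λ i j i<j → s<s⁻¹ (subst₂ Fin._<_ (sym (g-eq i)) (sym (g-eq j)) (inc _ _ (s<s i<j)))))))
  where
  extend : ∀ {f} → f ≗ g → (zero Vector.∷ (suc ∘ f)) ≗ e
  extend eq zero    = sym e0
  extend eq (suc i) = trans (cong suc (eq i)) (g-eq i)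
... | suc x
  with g , g-eq ← predecessors e (λ i → ℕ.<-≤-trans z<s (subst (λ y → toℕ y ≤ toℕ (e i)) e0 (increasing-head-≤ inc i)))
  = Any.++⁺ʳ _ (Any.map⁺ (Any.map (λ eq i → trans (cong suc (eq i)) (g-eq i))
      (allIncreasing-complete (suc r) n g
        (λ i j i<j → s<s⁻¹ (subst₂ Fin._<_ (sym (g-eq i)) (sym (g-eq j)) (inc _ _ i<j))))))

-- Permutations and their patterns

injective⇒surjective : ∀ {n} {f : Fin n → Fin n} → (∀ i j → f i ≡ f j → i ≡ j) → ∀ y → ∃ λ x → f x ≡ y
injective⇒surjective {n} {f} inj y with Fin.any? (λ x → f x Fin.≟ y)
... | yes hit = hit
... | no miss = contradiction collision no-collision
  where
  -- If y were missed, f with y adjoined would inject n + 1 points into n.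
  collision = Fin.pigeonhole (ℕ.n<1+n n) (y Vector.∷ f)
  no-collision : ¬ (∃₂ λ i j → i Fin.< j × (y Vector.∷ f) i ≡ (y Vector.∷ f) j)
  no-collision (zero  , suc j , _   , eq) = miss (j , sym eq)
  no-collision (suc i , suc j , i<j , eq) = ℕ.<⇒≢ i<j (cong (toℕ ∘ suc) (inj i j eq))

OrderIsomorphic : ∀ {r m n} → (Fin r → Fin m) → (Fin r → Fin n) → Set
OrderIsomorphic p q = ∀ i j → (p i Fin.< p j) ⇔ (q i Fin.< q j)

-- `q ∘ p⁻¹` is increasing, hence inflationary; at `p i` this is the claim.
perm-≤ : ∀ {r} {p q : Fin r → Fin r} → (∀ i j → p i ≡ p j → i ≡ j) →
         (∀ i j → p i Fin.< p j → q i Fin.< q j) → ∀ i → toℕ (p i) ≤ toℕ (q i)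
perm-≤ {p = p} {q} p-inj p⇒q i = subst (λ x → toℕ (p i) ≤ toℕ (q x)) (p-inj _ _ (p∘p⁻¹ (p i)))
  (increasing⇒inflationary {e = q ∘ p⁻¹}
    (λ u v u<v → p⇒q _ _ (subst₂ Fin._<_ (sym (p∘p⁻¹ u)) (sym (p∘p⁻¹ v)) u<v)) (p i))
  where
  p⁻¹ = λ y → proj₁ (injective⇒surjective p-inj y)
  p∘p⁻¹ = λ y → proj₂ (injective⇒surjective p-inj y)

orderIsomorphic-perms-≡ : ∀ {r} {π ρ : Vec (Fin r) r} → IsPerm π → IsPerm ρ →
                          OrderIsomorphic (lookup π) (lookup ρ) → π ≡ ρ
orderIsomorphic-perms-≡ {π = π} {ρ} π-perm ρ-perm iso = begin
  π                    ≡⟨ tabulate∘lookup π ⟨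
  tabulate (lookup π)  ≡⟨ tabulate-cong (λ i → Fin.toℕ-injective (ℕ.≤-antisym
                            (perm-≤ π-perm (λ u v → Equivalence.to (iso u v)) i)
                            (perm-≤ ρ-perm (λ u v → Equivalence.from (iso u v)) i))) ⟩
  tabulate (lookup ρ)  ≡⟨ tabulate∘lookup ρ ⟩
  ρ                    ∎
  where open ≡-Reasoning

lookup-AllPairs : ∀ {a ℓ} {A : Set a} {R : A → A → Set ℓ} {xs : List A} → AllPairs R xs →
                  ∀ {i j} → i Fin.< j → R (List.lookup xs i) (List.lookup xs j)
lookup-AllPairs (Rx ∷ _)  {zero}  {suc j} _   = All.lookup Rx (∈-lookup j)
lookup-AllPairs (_ ∷ Rxs) {suc i} {suc j} i<j = lookup-AllPairs Rxs (s<s⁻¹ i<j)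

-- By counting: `es` and `L` both have `n C k` entries. If two different choices of columns gave one
-- pattern, every pattern would occur at an index other than `i₁`, and `i₁` with one index per
-- pattern would make `suc (length L)` distinct indices into `es`.
prolific⇒distinct-patterns : ∀ {n k} (σ : Vec (Fin n) n) → k ≤ n → Prolific k σ →
  ∀ (e₁ e₂ : Fin (n ∸ k) → Fin n) → Increasing e₁ → Increasing e₂ →
  OrderIsomorphic (lookup σ ∘ e₁) (lookup σ ∘ e₂) → e₁ ≗ e₂
prolific⇒distinct-patterns {n} {k} σ k≤n (L , unique , L-patterns , length-L) e₁ e₂ inc₁ inc₂ iso u
  with e₁ u Fin.≟ e₂ u
... | yes e₁≡e₂ = e₁≡e₂
... | no  e₁≢e₂ = contradiction (Fin.pigeonhole few (i₁ Vector.∷ code)) no-collision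
  where
  r = n ∸ k
  es = allIncreasing r n

  few : length es < suc (length L)
  few = s≤s (ℕ.≤-reflexive (begin
    length es    ≡⟨ length-allIncreasing r n ⟩
    n C (n ∸ k)  ≡⟨ nCk≡nC[n∸k] k≤n ⟨
    n C k        ≡⟨ length-L ⟨
    length L     ∎))
    where open ≡-Reasoning

  at : Fin (length es) → Fin r → Fin n
  at = List.lookup es

  position : ∀ e → Increasing e → ∃ λ i → at i ≗ e
  position e inc = index e∈es , Any.lookup-index e∈es
    where e∈es = allIncreasing-complete r n e inc

  i₁ = proj₁ (position e₁ inc₁)
  i₂ = proj₁ (position e₂ inc₂)
  at-i₁ = proj₂ (position e₁ inc₁)
  at-i₂ = proj₂ (position e₂ inc₂)

  -- An occurrence at e₁ can be traded for one at e₂, so no pattern needs e₁.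
  occurrence : ∀ π → π ∈ L → ∃ λ i → i ≢ i₁ × OrderIsomorphic (lookup π) (lookup σ ∘ at i)
  occurrence π π∈L
    with _ , e , inc , π~e ← Equivalence.to (L-patterns π) π∈L
    with i , at-i ← position e inc
    with i Fin.≟ i₁
  ... | no  i≢i₁ = i , i≢i₁ , λ u v →
          subst₂ (λ x y → (lookup π u Fin.< lookup π v) ⇔ (lookup σ x Fin.< lookup σ y))
            (sym (at-i u)) (sym (at-i v)) (π~e u v)
  ... | yes refl = i₂ ,
          (λ i₂≡i₁ → e₁≢e₂ (trans (sym (at-i₁ u)) (trans (cong (λ i → at i u) (sym i₂≡i₁)) (at-i₂ u)))) ,
          λ u v → subst₂ (λ x y → (lookup π u Fin.< lookup π v) ⇔ (lookup σ x Fin.< lookup σ y))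
            (sym (at-i₂ u)) (sym (at-i₂ v))
            (⇔-trans (subst₂ (λ x y → (lookup π u Fin.< lookup π v) ⇔ (lookup σ x Fin.< lookup σ y))
              (trans (sym (at-i u)) (at-i₁ u)) (trans (sym (at-i v)) (at-i₁ v)) (π~e u v)) (iso u v))

  code : Fin (length L) → Fin (length es)
  code p = proj₁ (occurrence (List.lookup L p) (∈-lookup p))

  no-collision : ¬ (∃₂ λ p q → p Fin.< q × (i₁ Vector.∷ code) p ≡ (i₁ Vector.∷ code) q)
  no-collision (zero  , suc q , _   , eq) = proj₁ (proj₂ (occurrence _ (∈-lookup q))) (sym eq)
  -- Two entries of `L` with the same code are order isomorphic to the same restriction of `σ`,
  -- hence equal, against `unique`.
  no-collision (suc p , suc q , p<q , eq) = lookup-AllPairs unique (s<s⁻¹ p<q)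
    (orderIsomorphic-perms-≡ (perm p) (perm q) λ u v → ⇔-trans
      (subst (λ i → OrderIsomorphic (lookup (List.lookup L p)) (lookup σ ∘ at i)) eq (occ p) u v)
      (⇔-sym (occ q u v)))
    where
    perm : ∀ p → IsPerm (List.lookup L p)
    perm p = proj₁ (Equivalence.to (L-patterns _) (∈-lookup p))
    occ : ∀ p → OrderIsomorphic (lookup (List.lookup L p)) (lookup σ ∘ at (code p))
    occ p = proj₂ (proj₂ (occurrence _ (∈-lookup p)))

-- Close points give equal patterns

module _ {n : ℕ} {K : Set} {Hit : K → Fin n → Set} (hit? : ∀ κ c → Dec (Hit κ c))
         (hit-unique : ∀ κ {c c′} → Hit κ c → Hit κ c′ → c ≡ c′) where

  -- Each key rules out at most one point; if its point is already gone, some other point ≠ a is dropped.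
  avoid : ∀ {m a} (D : List K) → All (λ κ → ¬ Hit κ a) D →
          (e : Fin (length D + suc m) → Fin n) → Increasing e → ∀ q → e q ≡ a →
          ∃ λ (f : Fin (suc m) → Fin n) → Increasing f × (∃ λ p → f p ≡ a) ×
            (∀ u → All (λ κ → ¬ Hit κ (f u)) D) × (∀ u → ∃ λ w → f u ≡ e w)
  avoid [] [] e inc q eq = e , inc , (q , eq) , (λ _ → []) , (λ u → u , refl)
  avoid {m} {a} (κ ∷ D) (¬κa ∷ ¬Da) e inc q eq with pivot
    where
    pivot : ∃ λ w → w ≢ q × (∀ u → Hit κ (e u) → u ≡ w)
    pivot with Fin.any? (λ u → hit? κ (e u))
    ... | yes (w , h) = w , (λ { refl → ¬κa (subst (Hit κ) eq h) }) ,
                        (λ u h′ → increasing-injective inc u w (hit-unique κ h′ h))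
    -- One index must go all the same: `length D ↑ʳ zero` is an arbitrary choice, which `punchIn q`
    -- moves off `q`.
    ... | no  none    = punchIn q (length D ↑ʳ zero) , Fin.punchInᵢ≢i q _ ,
                        (λ u h → contradiction (u , h) none)
  ... | w , w≢q , only
    with f , inc-f , a∈f , f-avoids , f⊆ ← avoid D ¬Da (e ∘ punchIn w)
           (λ i j i<j → inc _ _ (Fin.≤∧≢⇒< (Fin.punchIn-mono-≤ w i j (ℕ.<⇒≤ i<j))
             (λ eq → ℕ.<⇒≢ i<j (cong toℕ (Fin.punchIn-injective w i j eq)))))
           (punchOut w≢q) (trans (cong e (Fin.punchIn-punchOut w≢q)) eq)
    = f , inc-f , a∈f
    , (λ u → (λ h → let v , fu≡ = f⊆ u in
         Fin.punchInᵢ≢i w v (only _ (subst (Hit κ) fu≡ h))) ∷ f-avoids u)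
    , (λ u → let v , fu≡ = f⊆ u in punchIn w v , fu≡)

gap : ℕ → ℕ → List ℕ
gap x y = applyUpTo (λ i → suc (x + i)) (y ∸ suc x)

∈-gap : ∀ {x y z} → x < z → z < y → z ∈ gap x y
∈-gap {x} {y} {z} x<z z<y = subst (_∈ gap x y) (ℕ.m+[n∸m]≡n x<z)
  (∈-applyUpTo⁺ (λ i → suc (x + i)) (ℕ.∸-monoˡ-< z<y x<z))

gap-lower : ∀ x y → All (x <_) (gap x y)
gap-lower x y = All.applyUpTo⁺₁ _ _ (λ {i} _ → s≤s (ℕ.m≤m+n x i))

gap-upper : ∀ x y → All (_< y) (gap x y)
gap-upper x y = All.applyUpTo⁺₁ _ _ (λ {i} i<y∸x → subst (suc x + i <_)
  (ℕ.m+[n∸m]≡n {suc x} {y} (ℕ.<⇒≤ (ℕ.m∸n≢0⇒n<m {y} {suc x} λ eq → ℕ.n≮0 (subst (i <_) eq i<y∸x))))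
  (ℕ.+-monoʳ-< (suc x) i<y∸x))

-- At most one of the two gaps is nonempty, so it need not be known which of `x` and `y` is larger.
between : ℕ → ℕ → List ℕ
between x y = gap x y ++ gap y x

between-≢ˡ : ∀ x y → All (x ≢_) (between x y)
between-≢ˡ x y = All.++⁺ (All.map ℕ.<⇒≢ (gap-lower x y)) (All.map ℕ.>⇒≢ (gap-upper y x))

length-between : ∀ {x y} → x ≢ y → suc (length (between x y)) ≡ ∣ x - y ∣
length-between {x} {y} x≢y = begin
  suc (length (between x y))             ≡⟨ cong suc (length-++ (gap x y)) ⟩
  suc (length (gap x y) + length (gap y x)) ≡⟨ cong suc (cong₂ _+_ (length-applyUpTo _ (y ∸ suc x)) (length-applyUpTo _ (x ∸ suc y))) ⟩
  suc ((y ∸ suc x) + (x ∸ suc y))        ≡⟨ lemma x y x≢y ⟩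
  ∣ x - y ∣                              ∎
  where
  open ≡-Reasoning
  lemma : ∀ x y → x ≢ y → suc ((y ∸ suc x) + (x ∸ suc y)) ≡ ∣ x - y ∣
  lemma zero    zero    0≢0 = contradiction refl 0≢0
  lemma zero    (suc y) _   = cong suc (ℕ.+-identityʳ y)
  lemma (suc x) zero    _   = refl
  lemma (suc x) (suc y) ne  = lemma x y (ne ∘ cong suc)

module SamePattern {n k m : ℕ} (s : Fin n → Fin n) (s-inj : ∀ i j → s i ≡ s j → i ≡ j)
  (n≡k+1+m : n ≡ k + suc m) (a b : Fin n) (a<b : a Fin.< b)
  (close : ∣ toℕ a - toℕ b ∣ + ∣ toℕ (s a) - toℕ (s b) ∣ ≤ suc k) where

  -- The key inj₁ v stands for column v, and inj₂ v for the column of the value v.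
  Key : Set
  Key = ℕ ⊎ ℕ

  Hit : Key → Fin n → Set
  Hit (inj₁ v) c = toℕ c ≡ v
  Hit (inj₂ v) c = toℕ (s c) ≡ v

  hit? : ∀ κ c → Dec (Hit κ c)
  hit? (inj₁ v) c = toℕ c ℕ.≟ v
  hit? (inj₂ v) c = toℕ (s c) ℕ.≟ v

  hit-unique : ∀ κ {c c′} → Hit κ c → Hit κ c′ → c ≡ c′
  hit-unique (inj₁ v) h h′ = Fin.toℕ-injective (trans h (sym h′))
  hit-unique (inj₂ v) h h′ = s-inj _ _ (Fin.toℕ-injective (trans h (sym h′)))

  a≢b : a ≢ b
  a≢b refl = ℕ.<-irrefl refl a<b

  columns values : List ℕ
  columns = between (toℕ a) (toℕ b)
  values  = between (toℕ (s a)) (toℕ (s b))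

  -- `required` removes `b` and clears the strips between `a` and `b` in both directions. Repeating
  -- the key of `b` pads the list to exactly `k` keys; `avoid` spends each repetition on some other
  -- point than `a`.
  required deleted : List Key
  required = inj₁ (toℕ b) ∷ map inj₁ columns ++ map inj₂ values
  deleted  = required ++ replicate (k ∸ length required) (inj₁ (toℕ b))

  -- Each strip takes one key fewer than its coordinate distance and `b` takes one: in all, one less
  -- than the taxicab distance.
  required-≤ : length required ≤ k
  required-≤ = s≤s⁻¹ (subst (_≤ suc k) (sym (begin
    suc (suc (length (map inj₁ columns ++ map inj₂ values)))
      ≡⟨ cong (2 +_) (trans (length-++ (map inj₁ columns)) (cong₂ _+_ (length-map inj₁ columns) (length-map inj₂ values))) ⟩
    suc (suc (length columns + length values))
      ≡⟨ cong suc (ℕ.+-suc (length columns) (length values)) ⟨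
    suc (length columns) + suc (length values)
      ≡⟨ cong₂ _+_ (length-between {toℕ a} {toℕ b} (a≢b ∘ Fin.toℕ-injective)) (length-between {toℕ (s a)} {toℕ (s b)} (a≢b ∘ s-inj _ _ ∘ Fin.toℕ-injective)) ⟩
    ∣ toℕ a - toℕ b ∣ + ∣ toℕ (s a) - toℕ (s b) ∣ ∎)) close)
    where open ≡-Reasoning

  deleted≡k : length deleted ≡ k
  deleted≡k = begin
    length deleted
      ≡⟨ length-++ required ⟩
    length required + length (replicate (k ∸ length required) _)
      ≡⟨ cong (length required +_) (length-replicate (k ∸ length required)) ⟩
    length required + (k ∸ length required)
      ≡⟨ ℕ.m+[n∸m]≡n required-≤ ⟩
    k ∎
    where open ≡-Reasoning

  a-kept : All (λ κ → ¬ Hit κ a) deleted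
  a-kept = All.++⁺
    (b-misses ∷ All.++⁺ (All.map⁺ {f = inj₁} (between-≢ˡ (toℕ a) (toℕ b)))
                         (All.map⁺ {f = inj₂} (between-≢ˡ (toℕ (s a)) (toℕ (s b)))))
    (All.replicate⁺ (k ∸ length required) b-misses)
    where
    b-misses : toℕ a ≢ toℕ b
    b-misses = a≢b ∘ Fin.toℕ-injective

  N≡n : length deleted + suc m ≡ n
  N≡n = trans (cong (_+ suc m) deleted≡k) (sym n≡k+1+m)

  survivors : ∃ λ (f : Fin (suc m) → Fin n) → Increasing f × (∃ λ p → f p ≡ a) ×
                (∀ u → All (λ κ → ¬ Hit κ (f u)) deleted) × (∀ u → ∃ λ w → f u ≡ cast N≡n w)
  survivors = avoid hit? hit-unique deleted a-kept (cast N≡n)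
    (λ i j i<j → subst₂ _<_ (sym (Fin.toℕ-cast N≡n i)) (sym (Fin.toℕ-cast N≡n j)) i<j)
    (cast (sym N≡n) a) (Fin.cast-involutive N≡n (sym N≡n) a)

  Kept : Fin n → Set
  Kept c = ∀ {κ} → κ ∈ required → ¬ Hit κ c

  kept≢b : ∀ {c} → Kept c → c ≢ b
  kept≢b kept c≡b = kept (here refl) (cong toℕ c≡b)

  not-column : ∀ {c v} → Kept c → v ∈ columns → toℕ c ≢ v
  not-column kept v∈ = kept (there (∈-++⁺ˡ (∈-map⁺ inj₁ v∈)))

  not-value : ∀ {c v} → Kept c → v ∈ values → toℕ (s c) ≢ v
  not-value kept v∈ = kept (there (∈-++⁺ʳ (map inj₁ columns) (∈-map⁺ inj₂ v∈)))

  replace : Fin n → Fin n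
  replace c with c Fin.≟ a
  ... | yes _ = b
  ... | no  _ = c

  -- The order of `x` and `y` is left open: only `z < y` has to be excluded, and it would put `z`
  -- into `gap x y`.
  pass-up : ∀ {x y z} → x < z → z ≢ y → z ∉ gap x y → y < z
  pass-up {x} {y} {z} x<z z≢y z∉ with ℕ.<-cmp z y
  ... | tri< z<y _ _ = contradiction (∈-gap x<z z<y) z∉
  ... | tri≈ _ z≡y _ = contradiction z≡y z≢y
  ... | tri> _ _ y<z = y<z

  pass-down : ∀ {x y z} → z < x → z ≢ y → z ∉ gap y x → z < y
  pass-down {x} {y} {z} z<x z≢y z∉ with ℕ.<-cmp z y
  ... | tri< z<y _ _ = z<y
  ... | tri≈ _ z≡y _ = contradiction z≡y z≢y
  ... | tri> _ _ y<z = contradiction (∈-gap y<z z<x) z∉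

  replace-increasing : ∀ {c d} → Kept c → Kept d → c Fin.< d → replace c Fin.< replace d
  replace-increasing {c} {d} kc kd c<d with c Fin.≟ a | d Fin.≟ a
  ... | yes refl | yes refl = contradiction c<d (ℕ.<-irrefl refl)
  ... | yes refl | no  d≢a  = pass-up c<d (kept≢b kd ∘ Fin.toℕ-injective)
                                (λ d∈ → not-column kd (∈-++⁺ˡ d∈) refl)
  ... | no  c≢a  | yes refl = ℕ.<-trans c<d a<b
  ... | no  c≢a  | no  d≢a  = c<d

  -- Every other kept value lies on the same side of `s a` and `s b`. As either of these may be the
  -- larger, one half of `values` serves one implication and the other half its converse.
  replace-order : ∀ {c d} → Kept c → Kept d → (s c Fin.< s d) ⇔ (s (replace c) Fin.< s (replace d))
  replace-order {c} {d} kc kd with c Fin.≟ a | d Fin.≟ a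
  ... | yes refl | yes refl = mk⇔ (λ lt → contradiction lt (ℕ.<-irrefl refl)) (λ lt → contradiction lt (ℕ.<-irrefl refl))
  ... | yes refl | no  d≢a  = mk⇔
          (λ lt → pass-up lt (kept≢b kd ∘ s-inj _ _ ∘ Fin.toℕ-injective) (λ d∈ → not-value kd (∈-++⁺ˡ d∈) refl))
          (λ lt → pass-up lt (d≢a ∘ s-inj _ _ ∘ Fin.toℕ-injective) (λ d∈ → not-value kd (∈-++⁺ʳ (gap (toℕ (s a)) (toℕ (s b))) d∈) refl))
  ... | no  c≢a  | yes refl = mk⇔
          (λ lt → pass-down lt (kept≢b kc ∘ s-inj _ _ ∘ Fin.toℕ-injective) (λ c∈ → not-value kc (∈-++⁺ʳ (gap (toℕ (s a)) (toℕ (s b))) c∈) refl))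
          (λ lt → pass-down lt (c≢a ∘ s-inj _ _ ∘ Fin.toℕ-injective) (λ c∈ → not-value kc (∈-++⁺ˡ c∈) refl))
  ... | no  c≢a  | no  d≢a  = mk⇔ (λ lt → lt) (λ lt → lt)

  replace-a : replace a ≡ b
  replace-a with a Fin.≟ a
  ... | yes _   = refl
  ... | no  a≢a = contradiction refl a≢a

  replace-same-pattern : (f : Fin (suc m) → Fin n) → Increasing f → ∀ p → f p ≡ a → (∀ u → Kept (f u)) →
    Increasing (replace ∘ f) × ¬ (f ≗ replace ∘ f) × OrderIsomorphic (s ∘ f) (s ∘ replace ∘ f)
  replace-same-pattern f inc p fp≡a kept =
    (λ i j i<j → replace-increasing (kept i) (kept j) (inc i j i<j)) ,
    (λ eq → a≢b (trans (sym fp≡a) (trans (eq p) (trans (cong replace fp≡a) replace-a)))) ,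
    (λ i j → replace-order (kept i) (kept j))

  same-pattern : ∃₂ λ (e₁ e₂ : Fin (suc m) → Fin n) → Increasing e₁ × Increasing e₂ × ¬ (e₁ ≗ e₂) ×
                   OrderIsomorphic (s ∘ e₁) (s ∘ e₂)
  same-pattern =
    let f , inc , (p , fp≡a) , avoids , _ = survivors in
    f , replace ∘ f , inc ,
    replace-same-pattern f inc p fp≡a (λ u κ∈ → All.lookup (avoids u) (∈-++⁺ˡ κ∈))

Separated : ∀ {n} → ℕ → (Fin n → Fin n) → Set
Separated d s = ∀ a b → a Fin.< b → d ≤ ∣ toℕ a - toℕ b ∣ + ∣ toℕ (s a) - toℕ (s b) ∣

prolific⇒separated : ∀ {n k} (σ : Vec (Fin n) n) → k < n → IsPerm σ → Prolific k σ →
                     Separated (2 + k) (lookup σ)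
-- Abstracting the distinctness statement along with `n ∸ k` turns its `Fin (n ∸ k)` into
-- `Fin (suc m)`, the domain of the maps from `SamePattern`.
prolific⇒separated {n} {k} σ k<n perm prol a b a<b with n ∸ k in n∸k≡ | prolific⇒distinct-patterns {n} {k} σ (ℕ.<⇒≤ k<n) prol
... | zero  | _ = contradiction k<n (ℕ.≤⇒≯ (ℕ.m∸n≡0⇒m≤n n∸k≡))
... | suc m | distinct = ℕ.≰⇒> λ close →
  let n≡ = trans (sym (ℕ.m+[n∸m]≡n (ℕ.<⇒≤ k<n))) (cong (k +_) n∸k≡)
      e₁ , e₂ , inc₁ , inc₂ , e₁≢e₂ , iso = SamePattern.same-pattern (lookup σ) perm n≡ a b a<b close
  in e₁≢e₂ (distinct e₁ e₂ inc₁ inc₂ iso)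

-- Packing diamonds

-- Sweeping left to right, P stands for twice the total width met so far.
sweep : ∀ {n} (pos w : Fin n → ℕ) P B M → P ≤ M + B →
        (∀ c → 0 < w c → P + w c ≤ 2 * pos c + B) →
        (∀ c → 0 < w c → w c + 2 * pos c ≤ M) →
        (∀ a b → a Fin.< b → 0 < w a → 0 < w b → w a + w b + 2 * pos a ≤ 2 * pos b) →
        P + 2 * sum w ≤ M + B
sweep {zero}  pos w P B M P≤ left right apart = subst (_≤ M + B) (sym (ℕ.+-identityʳ P)) P≤
sweep {suc n} pos w P B M P≤ left right apart =
  subst (_≤ M + B) (regroup P (w zero) (sum (w ∘ suc)))
    (sweep (pos ∘ suc) (w ∘ suc) (P + 2 * w zero) B M P′≤ left′ (right ∘ suc)
      (λ a b a<b → apart (suc a) (suc b) (s<s a<b)))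
  where
  open ℕ.≤-Reasoning
  regroup : ∀ P w₀ S → P + 2 * w₀ + 2 * S ≡ P + 2 * (w₀ + S)
  regroup = solve-∀
  drop : ∀ P {x} → x ≡ 0 → P + 2 * x ≡ P
  drop P refl = ℕ.+-identityʳ P
  e₁ : ∀ P x → P + 2 * x ≡ P + x + x
  e₁ = solve-∀
  e₂ : ∀ x B y → 2 * x + B + y ≡ y + 2 * x + B
  e₂ = solve-∀
  e₃ : ∀ P x y → P + 2 * x + y ≡ P + x + (x + y)
  e₃ = solve-∀
  P′≤ : P + 2 * w zero ≤ M + B
  P′≤ with w zero ℕ.≟ 0
  ... | yes w₀≡0 = subst (_≤ M + B) (sym (drop P w₀≡0)) P≤
  -- In doubled coordinates the interval of a column has centre `2 * pos` and radius `w`; this one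
  -- starts no earlier than P - B and ends no later than `M`.
  ... | no  w₀≢0 = begin
    P + 2 * w zero                 ≡⟨ e₁ P (w zero) ⟩
    P + w zero + w zero            ≤⟨ ℕ.+-monoˡ-≤ (w zero) (left zero (ℕ.n≢0⇒n>0 w₀≢0)) ⟩
    2 * pos zero + B + w zero      ≡⟨ e₂ (pos zero) B (w zero) ⟩
    w zero + 2 * pos zero + B      ≤⟨ ℕ.+-monoˡ-≤ B (right zero (ℕ.n≢0⇒n>0 w₀≢0)) ⟩
    M + B                          ∎
  left′ : ∀ c → 0 < w (suc c) → P + 2 * w zero + w (suc c) ≤ 2 * pos (suc c) + B
  left′ c wc>0 with w zero ℕ.≟ 0
  ... | yes w₀≡0 = subst (λ x → x + w (suc c) ≤ 2 * pos (suc c) + B) (sym (drop P w₀≡0)) (left (suc c) wc>0)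
  -- A later nonempty interval starts no earlier than this one ends, so all that has been met so far
  -- fits to the left of it.
  ... | no  w₀≢0 = begin
    P + 2 * w zero + w (suc c)                  ≡⟨ e₃ P (w zero) (w (suc c)) ⟩
    P + w zero + (w zero + w (suc c))           ≤⟨ ℕ.+-monoˡ-≤ _ (left zero (ℕ.n≢0⇒n>0 w₀≢0)) ⟩
    2 * pos zero + B + (w zero + w (suc c))     ≡⟨ e₂ (pos zero) B (w zero + w (suc c)) ⟩
    w zero + w (suc c) + 2 * pos zero + B       ≤⟨ ℕ.+-monoˡ-≤ B (apart zero (suc c) z<s (ℕ.n≢0⇒n>0 w₀≢0) wc>0) ⟩
    2 * pos (suc c) + B                         ∎

-- The length of the intersection of row y with the diamond of diameter d centred in row v.
width : ℕ → ℕ → ℕ → ℕ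
width d y v = d ∸ 2 * ∣ y - v ∣

-- A positive width is exactly `d` minus twice the vertical distance to `y`. The triangle inequality
-- through row `y` gives `d ≤ γ + (α + β)`, which is used twice.
width-apart : ∀ {n} d y (s : Fin n → Fin n) → Separated d s → let w = λ c → width d y (toℕ (s c)) in
              ∀ a b → a Fin.< b → 0 < w a → 0 < w b → w a + w b + 2 * toℕ a ≤ 2 * toℕ b
width-apart d y s sep a b a<b wa>0 wb>0 = ℕ.+-cancelʳ-≤ (2 * (α + β)) _ _ (begin
  wa + wb + 2 * toℕ a + 2 * (α + β)                     ≡⟨ e₁ wa wb (toℕ a) α β ⟩
  (wa + 2 * α) + (wb + 2 * β) + 2 * toℕ a               ≡⟨ cong (_+ 2 * toℕ a) (cong₂ _+_ (full (2 * α) wa>0) (full (2 * β) wb>0)) ⟩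
  d + d + 2 * toℕ a                                     ≤⟨ ℕ.+-monoˡ-≤ (2 * toℕ a) (ℕ.+-mono-≤ dist dist) ⟩
  (γ + (α + β)) + (γ + (α + β)) + 2 * toℕ a             ≡⟨ e₂ γ α β (toℕ a) ⟩
  2 * (toℕ a + γ) + 2 * (α + β)                         ≡⟨ cong (λ x → 2 * x + 2 * (α + β)) a+γ≡b ⟩
  2 * toℕ b + 2 * (α + β)                               ∎)
  where
  open ℕ.≤-Reasoning
  α = ∣ y - toℕ (s a) ∣
  β = ∣ y - toℕ (s b) ∣
  γ = ∣ toℕ a - toℕ b ∣
  wa = width d y (toℕ (s a))
  wb = width d y (toℕ (s b))
  e₁ : ∀ u v a α β → u + v + 2 * a + 2 * (α + β) ≡ (u + 2 * α) + (v + 2 * β) + 2 * a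
  e₁ = solve-∀
  e₂ : ∀ γ α β a → (γ + (α + β)) + (γ + (α + β)) + 2 * a ≡ 2 * (a + γ) + 2 * (α + β)
  e₂ = solve-∀
  full : ∀ x → 0 < d ∸ x → d ∸ x + x ≡ d
  full x pos = ℕ.m∸n+n≡m (ℕ.<⇒≤ (ℕ.m∸n≢0⇒n<m {d} {x} (ℕ.>⇒≢ pos)))
  a+γ≡b : toℕ a + γ ≡ toℕ b
  a+γ≡b = trans (cong (toℕ a +_) (ℕ.m≤n⇒∣m-n∣≡n∸m (ℕ.<⇒≤ a<b))) (ℕ.m+[n∸m]≡n (ℕ.<⇒≤ a<b))
  dist : d ≤ γ + (α + β)
  dist = ℕ.≤-trans (sep a b a<b) (ℕ.+-monoʳ-≤ γ (subst (λ x → ∣ toℕ (s a) - toℕ (s b) ∣ ≤ x + β)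
           (ℕ.∣-∣-comm (toℕ (s a)) y) (ℕ.∣-∣-triangle (toℕ (s a)) y (toℕ (s b)))))

sum-perm : ∀ {n} {s : Fin n → Fin n} → (∀ i j → s i ≡ s j → i ≡ j) → ∀ f → sum (f ∘ s) ≡ sum f
sum-perm {s = s} s-inj f = sym (sum-permute f (permutation s s⁻¹ s∘s⁻¹ (λ c → s-inj _ _ (s∘s⁻¹ (s c)))))
  where
  s⁻¹ = λ y → proj₁ (injective⇒surjective s-inj y)
  s∘s⁻¹ = λ y → proj₂ (injective⇒surjective s-inj y)

sum-toℕ-last : ∀ z (f : ℕ → ℕ) → sum {suc z} (f ∘ toℕ) ≡ sum {z} (f ∘ toℕ) + f z
sum-toℕ-last zero    f = ℕ.+-comm (f 0) 0
sum-toℕ-last (suc z) f = trans (cong (f 0 +_) (sum-toℕ-last z (f ∘ suc))) (sym (ℕ.+-assoc (f 0) _ _))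

-- What the points in the `z` nearest rows on one side contribute to the total width of a row.
halfSum : ℕ → ℕ → ℕ
halfSum d z = sum {z} (λ i → d ∸ 2 * suc (toℕ i))

sum-width : ∀ d y z → sum {y + suc z} (λ c → width d y (toℕ c)) ≡ halfSum d y + (d + halfSum d z)
sum-width d zero    z = refl
sum-width d (suc y) z = begin
  t + sum {y + suc z} (λ c → width d y (toℕ c))   ≡⟨ cong (t +_) (sum-width d y z) ⟩
  t + (halfSum d y + (d + halfSum d z))           ≡⟨ ℕ.+-assoc t _ _ ⟨
  t + halfSum d y + (d + halfSum d z)             ≡⟨ cong (_+ (d + halfSum d z)) (ℕ.+-comm t (halfSum d y)) ⟩
  halfSum d y + t + (d + halfSum d z)             ≡⟨ cong (_+ (d + halfSum d z)) (sum-toℕ-last y (λ i → d ∸ 2 * suc i)) ⟨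
  halfSum d (suc y) + (d + halfSum d z)           ∎
  where
  open ≡-Reasoning
  t = d ∸ 2 * suc y

halfSum-suc : ∀ d z → halfSum (2 + d) (suc z) ≡ d + halfSum d z
halfSum-suc d z = cong (d +_) (sum-cong-≗ {z} (λ i → cong (2 + d ∸_) (ℕ.*-suc 2 (suc (toℕ i)))))

-- The nonzero terms are `2 * g`, ..., 4, 2, all present once `z` reaches `g`. In the odd case below
-- they are the odd numbers under `2 * g`.
halfSum-even : ∀ {g z} → g ≤ z → g * suc g ≤ halfSum (2 + 2 * g) z
halfSum-even z≤n = z≤n
halfSum-even {suc g} {suc z} (s≤s g≤z) = begin
  suc g * suc (suc g)                  ≡⟨ e g ⟩
  2 * suc g + g * suc g                ≤⟨ ℕ.+-monoʳ-≤ (2 * suc g) (halfSum-even g≤z) ⟩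
  2 * suc g + halfSum (2 + 2 * g) z    ≡⟨ cong (λ x → 2 * suc g + halfSum x z) (ℕ.*-suc 2 g) ⟨
  2 * suc g + halfSum (2 * suc g) z    ≡⟨ halfSum-suc (2 * suc g) z ⟨
  halfSum (2 + 2 * suc g) (suc z)      ∎
  where
  open ℕ.≤-Reasoning
  e : ∀ g → suc g * suc (suc g) ≡ 2 * suc g + g * suc g
  e = solve-∀

halfSum-odd : ∀ {g z} → g ≤ z → g * g ≤ halfSum (1 + 2 * g) z
halfSum-odd z≤n = z≤n
halfSum-odd {suc g} {suc z} (s≤s g≤z) = begin
  suc g * suc g                            ≡⟨ e g ⟩
  1 + 2 * g + g * g                        ≤⟨ ℕ.+-monoʳ-≤ (1 + 2 * g) (halfSum-odd g≤z) ⟩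
  1 + 2 * g + halfSum (1 + 2 * g) z        ≡⟨ halfSum-suc (1 + 2 * g) z ⟨
  halfSum (2 + (1 + 2 * g)) (suc z)        ≡⟨ cong (λ x → halfSum (suc x) (suc z)) (ℕ.*-suc 2 g) ⟨
  halfSum (1 + 2 * suc g) (suc z)          ∎
  where
  open ℕ.≤-Reasoning
  e : ∀ g → suc g * suc g ≡ 1 + 2 * g + g * g
  e = solve-∀

-- For `p < r` the truncated start is 0 and the list runs past `p + r`. This is harmless: only its
-- length and the presence of all numbers within `r` of `p` count.
interval : ℕ → ℕ → List ℕ
interval p r = applyUpTo (p ∸ r +_) (suc (2 * r))

∈-interval : ∀ {y p r} → ∣ y - p ∣ ≤ r → y ∈ interval p r
∈-interval {y} {p} {r} near = subst (_∈ interval p r) (ℕ.m+[n∸m]≡n low)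
  (∈-applyUpTo⁺ (p ∸ r +_) {i = y ∸ (p ∸ r)} (s≤s (ℕ.m≤n+o⇒m∸n≤o y (p ∸ r) high)))
  where
  open ℕ.≤-Reasoning
  low : p ∸ r ≤ y
  low = ℕ.m≤n+o⇒m∸n≤o p r (begin
    p              ≤⟨ ℕ.m≤n+∣n-m∣ p y ⟩
    y + ∣ y - p ∣  ≤⟨ ℕ.+-monoʳ-≤ y near ⟩
    y + r          ≡⟨ ℕ.+-comm y r ⟩
    r + y          ∎)
  e : ∀ r x → r + x + r ≡ x + 2 * r
  e = solve-∀
  high : y ≤ p ∸ r + 2 * r
  high = begin
    y                    ≤⟨ ℕ.m≤n+∣m-n∣ y p ⟩
    p + ∣ y - p ∣        ≤⟨ ℕ.+-mono-≤ (ℕ.m≤n+m∸n p r) near ⟩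
    r + (p ∸ r) + r      ≡⟨ e r (p ∸ r) ⟩
    p ∸ r + 2 * r        ∎

-- A half diamond: the rows within distance < m ∸ c of f c, for some column c.
shadow : ∀ {n} → (Fin n → ℕ) → ℕ → List ℕ
shadow {zero}  f m       = []
shadow {suc n} f zero    = []
shadow {suc n} f (suc m) = interval (f zero) m ++ shadow (f ∘ suc) m

-- The intervals have the odd lengths 2m - 1, 2m - 3, ... until `m` or the columns run out.
length-shadow : ∀ {n} (f : Fin n → ℕ) m → length (shadow f m) ≤ m * m
length-shadow {zero}  f m       = z≤n
length-shadow {suc n} f zero    = z≤n
length-shadow {suc n} f (suc m) = begin
  length (interval (f zero) m ++ shadow (f ∘ suc) m)           ≡⟨ length-++ (interval (f zero) m) ⟩
  length (interval (f zero) m) + length (shadow (f ∘ suc) m)   ≡⟨ cong (_+ length (shadow (f ∘ suc) m)) (length-applyUpTo (f zero ∸ m +_) (suc (2 * m))) ⟩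
  suc (2 * m) + length (shadow (f ∘ suc) m)                    ≤⟨ ℕ.+-monoʳ-≤ (suc (2 * m)) (length-shadow (f ∘ suc) m) ⟩
  suc (2 * m) + m * m                                          ≡⟨ e m ⟩
  suc m * suc m                                                ∎
  where
  open ℕ.≤-Reasoning
  e : ∀ m → suc (2 * m) + m * m ≡ suc m * suc m
  e = solve-∀

∈-shadow : ∀ {n y m} (f : Fin n → ℕ) c → ∣ y - f c ∣ + toℕ c < m → y ∈ shadow f m
∈-shadow {y = y} {suc m} f zero    lt = ∈-++⁺ˡ (∈-interval (s≤s⁻¹ (subst (_< suc m) (ℕ.+-identityʳ ∣ y - f zero ∣) lt)))
∈-shadow {y = y} {suc m} f (suc c) lt = ∈-++⁺ʳ (interval (f zero) m)
  (∈-shadow (f ∘ suc) c (s≤s⁻¹ (subst (_< suc m) (ℕ.+-suc ∣ y - f (suc c) ∣ (toℕ c)) lt)))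

fresh : ∀ N s (D : List ℕ) → length D < N → ∃ λ y → s ≤ y × y < s + N × y ∉ D
fresh N s D D<N with Fin.any? {n = N} (λ i → ¬? (s + toℕ i ∈? D))
... | yes (i , ∉D) = s + toℕ i , ℕ.m≤m+n s (toℕ i) , ℕ.+-monoʳ-< s (Fin.toℕ<n i) , ∉D
... | no  none     = contradiction (Fin.pigeonhole D<N (index ∘ listed)) clash
  where
  listed : ∀ i → s + toℕ i ∈ D
  listed i = decidable-stable (s + toℕ i ∈? D) (λ ∉D → none (i , ∉D))
  clash : ¬ (∃₂ λ i j → i Fin.< j × index (listed i) ≡ index (listed j))
  clash (i , j , i<j , eq) = ℕ.<⇒≢ i<j (ℕ.+-cancelˡ-≡ s _ _ (begin
    s + toℕ i                          ≡⟨ Any.lookup-index (listed i) ⟩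
    List.lookup D (index (listed i))   ≡⟨ cong (List.lookup D) eq ⟩
    List.lookup D (index (listed j))   ≡⟨ Any.lookup-index (listed j) ⟨
    s + toℕ j                          ∎))
    where open ≡-Reasoning

-- A row with `h` rows on either side has total width at least `q + (d + q)`. Abstract `h` and `q`
-- let both parities of `d` share the argument; in either case the sum is d²/2 rounded up.
module Packing {n′ e : ℕ} (s : Fin (suc n′) → Fin (suc n′)) (s-inj : ∀ i j → s i ≡ s j → i ≡ j)
  (sep : Separated (2 + e) s) {h q : ℕ} (halfSum-≥ : ∀ {z} → h ≤ z → q ≤ halfSum (2 + e) z) where

  n d : ℕ
  n = suc n′
  d = 2 + e

  w : ℕ → Fin n → ℕ
  w y c = width d y (toℕ (s c))

  -- `B` and `A` are twice the lengths by which intervals may stick out beyond column 0 and column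
  -- `n′`.
  row-bound : ∀ {y} A B → h ≤ y → y + h < n →
              (∀ c → w y c ≤ 2 * toℕ c + B) → (∀ c → w y c + 2 * toℕ c ≤ 2 * n′ + A) →
              2 * (q + (d + q)) ≤ 2 * n′ + A + B
  row-bound {y} A B h≤y y+h<n left right = begin
    2 * (q + (d + q))                           ≤⟨ ℕ.*-monoʳ-≤ 2 (ℕ.+-mono-≤ (halfSum-≥ h≤y) (ℕ.+-monoʳ-≤ d (halfSum-≥ h≤z))) ⟩
    2 * (halfSum d y + (d + halfSum d z))       ≡⟨ cong (2 *_) (sum-width d y z) ⟨
    2 * sum {y + suc z} (λ c → width d y (toℕ c)) ≡⟨ cong (λ N → 2 * sum {N} (λ c → width d y (toℕ c))) y+1+z≡n ⟩
    2 * sum {n} (λ c → width d y (toℕ c))       ≡⟨ cong (2 *_) (sum-perm s-inj (λ c → width d y (toℕ c))) ⟨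
    2 * sum (w y)                               ≤⟨ sweep toℕ (w y) 0 B (2 * n′ + A) z≤n (λ c _ → left c) (λ c _ → right c) (width-apart d y s sep) ⟩
    2 * n′ + A + B                              ∎
    where
    open ℕ.≤-Reasoning
    z = n ∸ suc y
    h≤z : h ≤ z
    h≤z = ℕ.m+n≤o⇒m≤o∸n h (subst (_≤ n) (trans (cong suc (ℕ.+-comm y h)) (sym (ℕ.+-suc h y))) y+h<n)
    y+1+z≡n : y + suc z ≡ n
    y+1+z≡n = trans (ℕ.+-suc y z) (ℕ.m+[n∸m]≡n (ℕ.≤-trans (s≤s (ℕ.m≤m+n y h)) y+h<n))

  w≤d : ∀ y c → w y c ≤ d
  w≤d y c = ℕ.m∸n≤m d (2 * ∣ y - toℕ (s c) ∣)

  w≤e : ∀ y c → toℕ (s c) ≢ y → w y c ≤ e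
  w≤e y c sc≢y = ℕ.∸-monoʳ-≤ d (ℕ.*-monoʳ-≤ 2 (ℕ.n≢0⇒n>0 (λ eq → sc≢y (sym (ℕ.∣m-n∣≡0⇒m≡n eq)))))

  toℕ≤n′ : ∀ (c : Fin n) → toℕ c ≤ n′
  toℕ≤n′ c = s≤s⁻¹ (Fin.toℕ<n c)

  -- Only one column has its point in row h, so not both ends can stick out by the full radius.
  crude : h + h < n → 1 ≤ n′ → 2 * (q + (d + q)) ≤ 2 * n′ + (d + e)
  crude 2h<n 1≤n′ with toℕ (s zero) ℕ.≟ h
  ... | no  s₀≢h = subst (2 * (q + (d + q)) ≤_) (ℕ.+-assoc (2 * n′) d e)
        (row-bound d e ℕ.≤-refl 2h<n left right)
    where
    left : ∀ c → w h c ≤ 2 * toℕ c + e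
    left zero    = w≤e h zero s₀≢h
    -- Lying one column further in makes up, in doubled coordinates, for the difference 2 between
    -- `d` and `e`.
    left (suc c) = ℕ.≤-trans (w≤d h (suc c)) (ℕ.+-monoˡ-≤ e (ℕ.*-monoʳ-≤ 2 (s≤s z≤n)))
    right : ∀ c → w h c + 2 * toℕ c ≤ 2 * n′ + d
    right c = subst (_≤ 2 * n′ + d) (ℕ.+-comm (2 * toℕ c) (w h c)) (ℕ.+-mono-≤ (ℕ.*-monoʳ-≤ 2 (toℕ≤n′ c)) (w≤d h c))
  ... | yes s₀≡h = subst (2 * (q + (d + q)) ≤_) (trans (ℕ.+-assoc (2 * n′) e d) (cong (2 * n′ +_) (ℕ.+-comm e d)))
        (row-bound e d ℕ.≤-refl 2h<n (λ c → ℕ.≤-trans (w≤d h c) (ℕ.m≤n+m d (2 * toℕ c))) right)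
    where
    swap : ∀ c → w h c + 2 * toℕ c ≡ 2 * toℕ c + w h c
    swap c = ℕ.+-comm (w h c) (2 * toℕ c)
    shift : ∀ x e → 2 * x + (2 + e) ≡ 2 * suc x + e
    shift = solve-∀
    right : ∀ c → w h c + 2 * toℕ c ≤ 2 * n′ + e
    right c with toℕ c ℕ.≟ n′
    -- Row `h` has its point in column 0, and `1 ≤ n′` makes column `n′` a different one.
    ... | yes c≡n′ = subst (_≤ 2 * n′ + e) (sym (swap c)) (ℕ.+-mono-≤ (ℕ.*-monoʳ-≤ 2 (toℕ≤n′ c)) (w≤e h c sc≢h))
      where
      sc≢h : toℕ (s c) ≢ h
      sc≢h sc≡h = ℕ.<⇒≢ 1≤n′ (trans (cong toℕ (s-inj zero c (Fin.toℕ-injective (trans s₀≡h (sym sc≡h))))) c≡n′)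
    ... | no  c≢n′ = subst (_≤ 2 * n′ + e) (sym (swap c)) (ℕ.≤-trans (ℕ.+-monoʳ-≤ (2 * toℕ c) (w≤d h c))
          (subst (_≤ 2 * n′ + e) (sym (shift (toℕ c) e)) (ℕ.+-monoˡ-≤ e (ℕ.*-monoʳ-≤ 2 (ℕ.≤∧≢⇒< (toℕ≤n′ c) c≢n′)))))

  -- The more overhang `B` is allowed, the smaller the half diamond of size `m` to be avoided:
  -- `2 * m + B` only has to reach `d`.
  width-≤ : ∀ y v t m B → d ≤ 2 * m + B → ¬ (∣ y - v ∣ + t < m) → width d y v ≤ 2 * t + B
  width-≤ y v t m B d≤ far = ℕ.m≤n+o⇒m∸n≤o d (2 * ∣ y - v ∣) (begin
    d                              ≤⟨ d≤ ⟩
    2 * m + B                      ≤⟨ ℕ.+-monoˡ-≤ B (ℕ.*-monoʳ-≤ 2 (ℕ.≮⇒≥ far)) ⟩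
    2 * (∣ y - v ∣ + t) + B        ≡⟨ eq ∣ y - v ∣ t B ⟩
    2 * ∣ y - v ∣ + (2 * t + B)    ∎)
    where
    open ℕ.≤-Reasoning
    eq : ∀ x t B → 2 * (x + t) + B ≡ 2 * x + (2 * t + B)
    eq = solve-∀

  -- `n ∸ (h + h)` rows have `h` rows on either side, and the shadows hold at most
  -- `m₁ * m₁ + m₂ * m₂`, so some row escapes both. The shadow on the right is one on the left after
  -- reversing the columns by `Fin.opposite`.
  sharp : ∀ A B m₁ m₂ → d ≤ 2 * m₁ + B → d ≤ 2 * m₂ + A → m₁ * m₁ + m₂ * m₂ + (h + h) < n →
          2 * (q + (d + q)) ≤ 2 * n′ + A + B
  sharp A B m₁ m₂ d≤₁ d≤₂ room with fresh (n ∸ (h + h)) h D few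
    where
    D = shadow (toℕ ∘ s) m₁ ++ shadow (toℕ ∘ s ∘ Fin.opposite) m₂
    few : length D < n ∸ (h + h)
    few = ℕ.≤-<-trans (subst (_≤ m₁ * m₁ + m₂ * m₂) (sym (length-++ (shadow (toℕ ∘ s) m₁)))
            (ℕ.+-mono-≤ (length-shadow (toℕ ∘ s) m₁) (length-shadow (toℕ ∘ s ∘ Fin.opposite) m₂)))
            (ℕ.m+n≤o⇒m≤o∸n (suc (m₁ * m₁ + m₂ * m₂)) room)
  ... | y , h≤y , y< , y∉D = row-bound A B h≤y y+h<n
      (λ c → width-≤ y (toℕ (s c)) (toℕ c) m₁ B d≤₁ (λ near → y∉D (∈-++⁺ˡ (∈-shadow (toℕ ∘ s) c near))))
      (λ c → begin
        w y c + 2 * toℕ c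
          ≤⟨ ℕ.+-monoˡ-≤ (2 * toℕ c) (width-≤ y (toℕ (s c)) (toℕ (Fin.opposite c)) m₂ A d≤₂ (λ near →
               y∉D (∈-++⁺ʳ (shadow (toℕ ∘ s) m₁) (∈-shadow (toℕ ∘ s ∘ Fin.opposite) (Fin.opposite c)
                 (subst (λ c′ → ∣ y - toℕ (s c′) ∣ + toℕ (Fin.opposite c) < m₂)
                   (sym (Fin.opposite-involutive c)) near))))) ⟩
        2 * toℕ (Fin.opposite c) + A + 2 * toℕ c
          ≡⟨ eq (toℕ (Fin.opposite c)) A (toℕ c) ⟩
        2 * (toℕ (Fin.opposite c) + toℕ c) + A
          ≡⟨ cong (λ x → 2 * x + A) (trans (cong (_+ toℕ c) (Fin.opposite-prop c)) (ℕ.m∸n+n≡m (toℕ≤n′ c))) ⟩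
        2 * n′ + A ∎)
    where
    open ℕ.≤-Reasoning
    eq : ∀ o A c → 2 * o + A + 2 * c ≡ 2 * (o + c) + A
    eq = solve-∀
    y+h<n : y + h < n
    y+h<n = begin-strict
      y + h                          <⟨ ℕ.+-monoˡ-< h y< ⟩
      h + (n ∸ (h + h)) + h          ≡⟨ comm h (n ∸ (h + h)) ⟩
      n ∸ (h + h) + (h + h)          ≡⟨ ℕ.m∸n+n≡m (ℕ.≤-trans (ℕ.m≤n+m (h + h) (m₁ * m₁ + m₂ * m₂)) (ℕ.<⇒≤ room)) ⟩
      n                              ∎
      where
      comm : ∀ h x → h + x + h ≡ x + (h + h)
      comm = solve-∀

-- Arithmetic for even and odd `k`

parity : ∀ k → ∃ λ g → k ≡ 2 * g ⊎ k ≡ 1 + 2 * g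
parity zero = 0 , inj₁ refl
parity (suc k) with parity k
... | g , inj₁ eq = g , inj₂ (cong suc eq)
... | g , inj₂ eq = suc g , inj₁ (trans (cong suc eq) (sym (ℕ.*-suc 2 g)))

⌈even/2⌉ : ∀ {x} y → x ≡ 2 * y → ⌈ x /2⌉ ≡ y
⌈even/2⌉ y refl = trans (cong (λ z → ⌈ y + z /2⌉) (ℕ.+-identityʳ y)) (sym (ℕ.n≡⌈n+n/2⌉ y))

⌈odd/2⌉ : ∀ {x} y → x ≡ 1 + 2 * y → ⌈ x /2⌉ ≡ suc y
⌈odd/2⌉ y refl = cong suc (trans (cong (λ z → ⌊ y + z /2⌋) (ℕ.+-identityʳ y)) (sym (ℕ.n≡⌊n+n/2⌋ y)))

halve : ∀ {X Y} x y c → X ≤ Y → X ≡ 2 * x + c → Y ≡ 2 * y + c → x ≤ y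
halve x y c X≤Y refl refl = ℕ.*-cancelˡ-≤ 2 (ℕ.+-cancelʳ-≤ c (2 * x) (2 * y) X≤Y)

-- Columns 0 and 1 differ by 1 and their rows by at most `n′`. This provides the `h + h < n` that
-- `crude` asks for.
separated-≥ : ∀ {n′ d} (s : Fin (suc n′) → Fin (suc n′)) → 1 ≤ n′ → Separated d s → d ≤ suc n′
separated-≥ {suc n′} s _ sep = ℕ.≤-trans (sep zero (suc zero) z<s)
  (s≤s (ℕ.≤-trans (ℕ.∣m-n∣≤m⊔n (toℕ (s zero)) (toℕ (s (suc zero)))) (ℕ.⊔-lub (s≤s⁻¹ (Fin.toℕ<n (s zero))) (s≤s⁻¹ (Fin.toℕ<n (s (suc zero)))))))

separated⇒large : ∀ {n′ k} (s : Fin (suc n′) → Fin (suc n′)) → (∀ i j → s i ≡ s j → i ≡ j) →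
                  1 ≤ n′ → Separated (2 + k) s → ⌈ k * k /2⌉ + 2 * k + 1 ≤ suc n′
separated⇒large {n′} {k} s s-inj 1≤n′ sep with parity k
-- Here `d` is `2 * g + 2`, so shadows of size `g` on both sides go with `A = B = 2`, and `crude`
-- leaves enough rows.
... | g , inj₁ refl =
  subst (_≤ suc n′) (trans (fin g) (cong (λ x → x + 2 * (2 * g) + 1) (sym (⌈even/2⌉ (2 * (g * g)) (sq g)))))
    (s≤s (halve (2 * (g * g) + 4 * g) n′ 4 (sharp 2 2 g g (ℕ.≤-reflexive (ℕ.+-comm 2 (2 * g))) (ℕ.≤-reflexive (ℕ.+-comm 2 (2 * g))) room)
      (sharp-lhs g) (ℕ.+-assoc (2 * n′) 2 2)))
  where
  open Packing s s-inj sep {g} {g * suc g} halfSum-even using (crude; sharp)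
  fin : ∀ g → suc (2 * (g * g) + 4 * g) ≡ 2 * (g * g) + 2 * (2 * g) + 1
  fin = solve-∀
  sq : ∀ g → 2 * g * (2 * g) ≡ 2 * (2 * (g * g))
  sq = solve-∀
  sharp-lhs : ∀ g → 2 * (g * suc g + (2 + 2 * g + g * suc g)) ≡ 2 * (2 * (g * g) + 4 * g) + 4
  sharp-lhs = solve-∀
  crude-lhs : ∀ g → 2 * (g * suc g + (2 + 2 * g + g * suc g)) ≡ 2 * (suc (2 * (g * g) + 2 * g)) + (2 + 2 * g + 2 * g)
  crude-lhs = solve-∀
  2g<n : g + g < suc n′
  2g<n = ℕ.≤-trans (subst (λ x → suc (g + x) ≤ 2 + 2 * g) (ℕ.+-identityʳ g) (ℕ.n≤1+n _)) (separated-≥ s 1≤n′ sep)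
  count : ∀ g → g * g + g * g + (g + g) ≡ 2 * (g * g) + 2 * g
  count = solve-∀
  room : g * g + g * g + (g + g) < suc n′
  room = subst (_< suc n′) (sym (count g)) (ℕ.m<n⇒m<1+n
    (halve (suc (2 * (g * g) + 2 * g)) n′ _ (crude 2g<n 1≤n′) (crude-lhs g) refl))
-- Here `d` is `2 * g + 3`. Reaching `A + B = 4` by `A = B = 2` would take size `suc g` on both
-- sides, more rows than `crude` is sure to leave. `A = 3` and `B = 1` get by with sizes `g` and
-- `suc g`, for which its bound just suffices.
... | g , inj₂ refl =
  subst (_≤ suc n′) (trans (fin g) (cong (λ x → x + 2 * (1 + 2 * g) + 1) (sym (⌈odd/2⌉ (2 * (g * g) + 2 * g) (sq g)))))
    (s≤s (halve (2 * (g * g) + 6 * g + 3) n′ 4 (sharp 3 1 (suc g) g (ℕ.≤-reflexive (d₁ g)) (ℕ.≤-reflexive (d₂ g)) room)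
      (sharp-lhs g) (ℕ.+-assoc (2 * n′) 3 1)))
  where
  tail : ∀ {z} → suc g ≤ z → suc g * suc g ≤ halfSum (3 + 2 * g) z
  tail {z} g<z = subst (λ x → suc g * suc g ≤ halfSum (suc x) z) (ℕ.*-suc 2 g) (halfSum-odd g<z)
  open Packing s s-inj sep {suc g} {suc g * suc g} tail using (crude; sharp)
  d₁ : ∀ g → 3 + 2 * g ≡ 2 * suc g + 1
  d₁ = solve-∀
  d₂ : ∀ g → 3 + 2 * g ≡ 2 * g + 3
  d₂ = solve-∀
  fin : ∀ g → suc (2 * (g * g) + 6 * g + 3) ≡ suc (2 * (g * g) + 2 * g) + 2 * (1 + 2 * g) + 1
  fin = solve-∀
  sq : ∀ g → (1 + 2 * g) * (1 + 2 * g) ≡ 1 + 2 * (2 * (g * g) + 2 * g)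
  sq = solve-∀
  sharp-lhs : ∀ g → 2 * (suc g * suc g + (3 + 2 * g + suc g * suc g)) ≡ 2 * (2 * (g * g) + 6 * g + 3) + 4
  sharp-lhs = solve-∀
  crude-lhs : ∀ g → 2 * (suc g * suc g + (3 + 2 * g + suc g * suc g)) ≡ 2 * (2 * (g * g) + 4 * g + 3) + (3 + 2 * g + (1 + 2 * g))
  crude-lhs = solve-∀
  2h<n : suc g + suc g < suc n′
  2h<n = ℕ.≤-trans (ℕ.≤-reflexive (two g)) (separated-≥ s 1≤n′ sep)
    where
    two : ∀ g → suc (suc g + suc g) ≡ 3 + 2 * g
    two = solve-∀
  count : ∀ g → suc g * suc g + g * g + (suc g + suc g) ≡ 2 * (g * g) + 4 * g + 3
  count = solve-∀
  room : suc g * suc g + g * g + (suc g + suc g) < suc n′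
  room = subst (_< suc n′) (sym (count g)) (s≤s
    (halve (2 * (g * g) + 4 * g + 3) n′ _ (crude 2h<n 1≤n′) (crude-lhs g) refl))

theorem3p4 : (k n : ℕ) → 1 ≤ k → k < n → (σ : Vec (Fin n) n) → IsPerm σ → Prolific k σ → ⌈ k * k /2⌉ + 2 * k + 1 ≤ n
theorem3p4 k (suc n′) 1≤k k<n σ σ-perm prolific =
  separated⇒large (lookup σ) σ-perm (ℕ.≤-trans 1≤k (s≤s⁻¹ k<n)) (prolific⇒separated σ k<n σ-perm prolific)
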